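{- Let $a,b$ be integers with $0<b<a$, let $S=\langle a,a+1,\ldots,a+b\rangle$ with conductor $c$, and let $m\ge 2c-1$. Then every ordered $(S,m,r)$-amenable set is an optimal configuration of cardinality $r$.
   Context: For $x\in S$, $\mathrm D(x)=\{\alpha\in S\mid x-\alpha\in S\}$, and for a set $M\subseteq S$, $\mathrm D(M)=\bigcup_{x\in M}\mathrm D(x)$. For $m\in S$, $\delta^r(m)=\min\{\sharp\mathrm D(\{m_1,\ldots,m_r\})\mid m\le m_1<\cdots<m_r,\ m_i\in S\}$. A finite subset of $S\cap[m,\infty)$ is a configuration; a configuration $M$ of cardinality $r$ is optimal if $\sharp\mathrm D(M)=\delta^r(m)$. A set $M=\{m_1<\cdots<m_r\}\subseteq S$ with $2c-1\le m=m_1$ is $(S,m,r)$-amenable if $\mathrm D(m_i)\cap[m,\infty)\subseteq M$ for all $i$. The ground is $\{m,m+1,\ldots,m+a+b-1\}$, and the shadow of $M$ is $M\cap\{m,\ldots,m+a+b-1\}$. For a finite $M\subseteq S\cap[m,\infty)$, let $J$ be the set of $j\in\{0,\ldots,a-1\}$ such that $x-(m+b)=qa+j$ for some $x\in M$ and some integer $q\ge 0$; if $J\neq\emptyset$ let $j_0=\max J$ and let the wagon of $M$ be $W=\{x\in M\mid x-(m+b)=qa+j_0\text{ for some integer }q\}$. An element $P\in M$ is the pivot of $M$ if either $P<m+b$ and $P=\max M$, or $P=\max W$. An $(S,m,r)$-amenable set $M$ with pivot $P$ is ordered amenable if (i) its shadow is $\{m,m+1,\ldots,m+t\}$ for some integer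 $0\le t<a+b-1$, and (ii) whenever $s\in S\setminus M$ is such that $M\cup\{s\}$ is $(S,m,r+1)$-amenable with the same shadow as $M$, we have $s=P+a$. -}

module Defs where

open import Data.Integer.Base as ℤ using (ℤ; +_)
open import Data.List.Base using (List; length)
open import Data.List.Membership.Propositional using () renaming (_∈_ to _∈ˡ_)
open import Data.List.Relation.Unary.Unique.Propositional using (Unique)
open import Data.Nat.Base using (ℕ; zero; suc; _+_; _*_; _∸_; _≤_; _<_)
open import Data.Product.Base using (Σ-syntax; ∃-syntax; _×_)
open import Data.Sum.Base using (_⊎_)
open import Function.Bundles using (_⇔_)
open import Level using (Level; 0ℓ) renaming (suc to lsuc)
open import Relation.Binary.PropositionalEquality using (_≡_)
open import Relation.Unary using (Pred; _∈_; _∉_; _⊆_; _≐_; _∩_; _∪_; ｛_｝)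

-- Sets of natural numbers are predicates; equality of sets is _≐_.
-- A set is finite when some duplicate-free list enumerates it.

ℕSet : Set₁
ℕSet = Pred ℕ 0ℓ

HasCard : ℕSet → ℕ → Set
HasCard X n =
  Σ[ xs ∈ List ℕ ] (Unique xs × (∀ x → (x ∈ˡ xs) ⇔ (x ∈ X)) × length xs ≡ n)

IsLeast : {ℓ : Level} → Pred ℕ ℓ → ℕ → Set ℓ
IsLeast X n = n ∈ X × (∀ k → k ∈ X → n ≤ k)

IsGreatest : {ℓ : Level} → Pred ℕ ℓ → ℕ → Set ℓ
IsGreatest X n = n ∈ X × (∀ k → k ∈ X → k ≤ n)

data ⟨_⟩ (G : ℕSet) : ℕSet where
  gen  : ∀ {g} → g ∈ G → g ∈ ⟨ G ⟩
  zero : 0 ∈ ⟨ G ⟩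
  add  : ∀ {x y} → x ∈ ⟨ G ⟩ → y ∈ ⟨ G ⟩ → (x + y) ∈ ⟨ G ⟩

[_⋯_] : ℕ → ℕ → ℕSet
[ k ⋯ l ] x = k ≤ x × x ≤ l

[_,∞⟩ : ℕ → ℕSet
[ k ,∞⟩ x = k ≤ x

IsConductor : ℕSet → ℕ → Set
IsConductor S = IsLeast (λ c → [ c ,∞⟩ ⊆ S)

-- The conjunct α ≤ x makes the truncated difference the true one.
D : ℕSet → ℕ → ℕSet
D S x α = α ∈ S × α ≤ x × (x ∸ α) ∈ S

D∪ : ℕSet → ℕSet → ℕSet
D∪ S M α = ∃[ x ] (x ∈ M × α ∈ D S x)

record Configuration (S : ℕSet) (m r : ℕ) (M : ℕSet) : Set where
  field
    subset : M ⊆ S ∩ [ m ,∞⟩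
    card   : HasCard M r

-- IsDelta S m r d  means  δʳ(m) = d.
IsDelta : ℕSet → ℕ → ℕ → ℕ → Set₁
IsDelta S m r =
  IsLeast (λ d → Σ[ M ∈ ℕSet ] (Configuration S m r M × HasCard (D∪ S M) d))

record OptimalConfiguration (S : ℕSet) (m r : ℕ) (M : ℕSet) : Set₁ where
  field
    configuration : Configuration S m r M
    optimal       : ∃[ d ] (HasCard (D∪ S M) d × IsDelta S m r d)

-- c is the conductor of S.
record Amenable (S : ℕSet) (c m r : ℕ) (M : ℕSet) : Set where
  field
    subset : M ⊆ S
    card   : HasCard M r
    bound  : 2 * c ∸ 1 ≤ m
    least  : IsLeast M m
    closed : ∀ x → x ∈ M → D S x ∩ [ m ,∞⟩ ⊆ M

module _ (a b : ℕ) where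

  intervalSemigroup : ℕSet
  intervalSemigroup = ⟨ [ a ⋯ a + b ] ⟩

  Ground : ℕ → ℕSet
  Ground m = [ m ⋯ m + a + b ∸ 1 ]

  Shadow : ℕ → ℕSet → ℕSet
  Shadow m M = M ∩ Ground m

  -- x - (m + b) = q a + j in ℤ.
  Position : ℕ → ℕ → ℤ → ℕ → Set
  Position m x q j = + x ℤ.- + (m + b) ≡ q ℤ.* + a ℤ.+ + j

  J : ℕ → ℕSet → ℕSet
  J m M j = j < a × (∃[ x ] ∃[ q ] (x ∈ M × Position m x (+ q) j))

  -- The wagon of M is the case j₀ = max J; here q may be negative.
  Wagon : ℕ → ℕSet → ℕ → ℕSet
  Wagon m M j₀ x = x ∈ M × (∃[ q ] Position m x q j₀)

  IsPivot : ℕ → ℕSet → ℕ → Set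
  IsPivot m M P =
    P ∈ M ×
    ((P < m + b × IsGreatest M P) ⊎
     (∃[ j₀ ] (IsGreatest (J m M) j₀ × IsGreatest (Wagon m M j₀) P)))

  record OrderedAmenable (c m r : ℕ) (M : ℕSet) : Set where
    field
      amenable : Amenable intervalSemigroup c m r M
      pivot    : ℕ
      isPivot  : IsPivot m M pivot
      shadow   : ∃[ t ] (t < a + b ∸ 1 × Shadow m M ≐ [ m ⋯ m + t ])
      ordered  : ∀ s → s ∈ intervalSemigroup → s ∉ M →
                 Amenable intervalSemigroup c m (suc r) (M ∪ ｛ s ｝) →
                 Shadow m (M ∪ ｛ s ｝) ≐ Shadow m M →
                 s ≡ pivot + a

{-# OPTIONS --safe #-}

-- Let X be a configuration with least element e, and write n = a + b.
-- Below = { x ≥ 0 | e + x ∈ X - S } and Gap = { y > 0 | e - y ∉ X - S }.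
-- Every y ∈ Gap is smaller than c, so e - y ≥ c lies in S, and therefore
--   # D(X) = # (S ∩ [0 , e)) - # Gap + # Below.
-- Let T = Below ∩ [0 , n), and cut Gap and the rest of Below into blocks of
-- length a.  If e - (k+1)a + z ∉ X - S with 0 ≤ z < a, then z, …, z + (k+1)b
-- are elements of [0 , n) outside T, so a nonempty k-th block of Gap has at
-- most n - # T - (k+1)b elements, with equality if T is an initial interval.
-- Dually, if n + ka + i ∈ Below, then (k+1)b + 1 consecutive residues modulo
-- n lie in T, so if T ≠ [0 , n) the k-th block of Below has at most
-- # T - (k+1)b elements.  An ordered amenable set with shadow {m , …, m + t}
-- contains every element that shadow {m , …, m + t - 1} allows.  Comparing
-- blocks, a configuration X of the same cardinality has # T ≥ t + 1, hence
-- at most as many gaps.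

module Submission where

open import Data.Nat.Base
open import Data.Nat.Properties
open import Data.Nat.DivMod using (_%_; [m+n]%n≡m%n; [m+kn]%n≡m%n; m<n⇒m%n≡m; m%n<n)
open import Data.Nat.Induction using (<-wellFounded)
open import Data.Nat.Tactic.RingSolver using (solve-∀)
import Data.Integer.Base as ℤ
import Data.Integer.Properties as ℤ
import Data.Integer.Tactic.RingSolver as ℤ-Solver
open import Data.List.Base using (_∷_; length; filter; downFrom)
open import Data.List.Extrema.Nat using (min; max; min≤xs; xs≤max; argmin-sel; min≤v⁺)
open import Data.List.Membership.DecPropositional _≟_ using (_∈?_)
open import Data.List.Membership.Propositional.Properties using (∈-filter⁺; ∈-filter⁻; ∈-downFrom⁺)
open import Data.List.Membership.Propositional.Properties.WithK using (unique∧set⇒bag)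
open import Data.List.Relation.Binary.BagAndSetEquality using (∼bag⇒↭)
open import Data.List.Relation.Binary.Permutation.Propositional.Properties using (↭-length)
import Data.List.Relation.Unary.All as All
open import Data.List.Relation.Unary.AllPairs using (_∷_)
open import Data.List.Relation.Unary.Any using (here; there)
import Data.List.Relation.Unary.Unique.Propositional.Properties as Unique
open import Data.Product.Base using (∃-syntax; _×_; _,_; proj₁; proj₂)
open import Data.Sum.Base using (_⊎_; inj₁; inj₂)
open import Function.Base using (_∘_; id)
open import Function.Bundles using (_⇔_; mk⇔; Equivalence)
open import Function.Properties.Equivalence using () renaming (sym to ⇔-sym; trans to ⇔-trans)
open import Induction.WellFounded using (Acc; acc)
open import Relation.Binary.PropositionalEquality hiding (J)
open import Relation.Nullary using (¬_; yes; no; contradiction)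
open import Relation.Nullary.Decidable using (¬?; map′; _×-dec_)
open import Relation.Unary using (Decidable; _⊆_; _∪_; _∩_; ｛_｝; _≐_)
open import Defs

-- Counting in initial segments of the natural numbers.

private variable
  P Q R : ℕSet

-- `downFrom` lists the largest number first, so splitting on `P? n` unfolds `count P? (suc n)`; the
-- filtered list itself later serves as the enumeration that `HasCard` asks for.
count : Decidable P → ℕ → ℕ
count P? n = length (filter P? (downFrom n))

count-mono : (P? : Decidable P) (Q? : Decidable Q) → ∀ n →
             (∀ i → i < n → P i → Q i) → count P? n ≤ count Q? n
count-mono P? Q? zero    P⇒Q = z≤n
count-mono P? Q? (suc n) P⇒Q with P? n | Q? n
... | yes p | yes _ = s≤s (count-mono P? Q? n λ i i<n → P⇒Q i (m<n⇒m<1+n i<n))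
... | yes p | no ¬q = contradiction (P⇒Q n ≤-refl p) ¬q
... | no _  | yes _ = m≤n⇒m≤1+n (count-mono P? Q? n λ i i<n → P⇒Q i (m<n⇒m<1+n i<n))
... | no _  | no _  = count-mono P? Q? n λ i i<n → P⇒Q i (m<n⇒m<1+n i<n)

count-cong : (P? : Decidable P) (Q? : Decidable Q) → ∀ n →
             (∀ i → i < n → P i ⇔ Q i) → count P? n ≡ count Q? n
count-cong P? Q? n P⇔Q = ≤-antisym
  (count-mono P? Q? n λ i i<n → Equivalence.to (P⇔Q i i<n))
  (count-mono Q? P? n λ i i<n → Equivalence.from (P⇔Q i i<n))

count-+ : (P? : Decidable P) → ∀ m n →
          count P? (m + n) ≡ count P? m + count (λ i → P? (m + i)) n
count-+ P? m zero    = trans (cong (count P?) (+-identityʳ m)) (sym (+-identityʳ _))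
count-+ P? m (suc n) = trans (cong (count P?) (+-suc m n)) helper
  where
  helper : count P? (suc (m + n)) ≡ count P? m + count (λ i → P? (m + i)) (suc n)
  helper with P? (m + n)
  ... | yes _ = trans (cong suc (count-+ P? m n)) (sym (+-suc (count P? m) _))
  ... | no _  = count-+ P? m n

count-none : (P? : Decidable P) → ∀ n → (∀ i → i < n → ¬ P i) → count P? n ≡ 0
count-none P? zero    ¬P = refl
count-none P? (suc n) ¬P with P? n
... | yes p = contradiction p (¬P n ≤-refl)
... | no _  = count-none P? n λ i i<n → ¬P i (m<n⇒m<1+n i<n)

count-all : (P? : Decidable P) → ∀ n → (∀ i → i < n → P i) → count P? n ≡ n
count-all P? zero    all = refl
count-all P? (suc n) all with P? n
... | yes _ = cong suc (count-all P? n λ i i<n → all i (m<n⇒m<1+n i<n))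
... | no ¬p = contradiction (all n ≤-refl) ¬p

count-monoʳ : (P? : Decidable P) → ∀ {m n} → m ≤ n → count P? m ≤ count P? n
count-monoʳ P? {m} {n} m≤n = begin
  count P? m                                      ≤⟨ m≤m+n _ _ ⟩
  count P? m + count (λ i → P? (m + i)) (n ∸ m)   ≡⟨ count-+ P? m (n ∸ m) ⟨
  count P? (m + (n ∸ m))                          ≡⟨ cong (count P?) (m+[n∸m]≡n m≤n) ⟩
  count P? n                                      ∎
  where open ≤-Reasoning

count-support : (P? : Decidable P) → ∀ {m n} → m ≤ n → (∀ i → m ≤ i → ¬ P i) →
                count P? m ≡ count P? n
count-support P? {m} {n} m≤n ¬P = begin
  count P? m                                      ≡⟨ +-identityʳ _ ⟨
  count P? m + 0                                  ≡⟨ cong (count P? m +_) (count-none _ (n ∸ m) λ i _ → ¬P (m + i) (m≤m+n m i)) ⟨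
  count P? m + count (λ i → P? (m + i)) (n ∸ m)   ≡⟨ count-+ P? m (n ∸ m) ⟨
  count P? (m + (n ∸ m))                          ≡⟨ cong (count P?) (m+[n∸m]≡n m≤n) ⟩
  count P? n                                      ∎
  where open ≡-Reasoning

-- The bound `z < n` is asked only of members of the interval, so an empty interval may lie
-- anywhere.
count-interval : (P? : Decidable P) → ∀ s u n →
                 (∀ z → s ≤ z → z < u → z < n × P z) → u ∸ s ≤ count P? n
count-interval P? s u n run with u ≤? s
... | yes u≤s = subst (_≤ count P? n) (sym (m≤n⇒m∸n≡0 u≤s)) z≤n
... | no  u≰s = begin
  u ∸ s                                         ≡⟨ count-all _ (u ∸ s) (λ i i<u∸s → proj₂ (run (s + i) (m≤m+n s i) (s+i<u i<u∸s))) ⟨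
  count (λ i → P? (s + i)) (u ∸ s)              ≤⟨ m≤n+m _ _ ⟩
  count P? s + count (λ i → P? (s + i)) (u ∸ s) ≡⟨ count-+ P? s (u ∸ s) ⟨
  count P? (s + (u ∸ s))                        ≡⟨ cong (count P?) (m+[n∸m]≡n s≤u) ⟩
  count P? u                                    ≤⟨ count-monoʳ P? (u≤n u≰s run) ⟩
  count P? n                                    ∎
  where
  open ≤-Reasoning
  s≤u = <⇒≤ (≰⇒> u≰s)
  s+i<u : ∀ {i} → i < u ∸ s → s + i < u
  s+i<u i< = subst (s + _ <_) (m+[n∸m]≡n s≤u) (+-monoʳ-< s i<)
  u≤n : ∀ {u} → ¬ u ≤ s → (∀ z → s ≤ z → z < u → z < n × _) → u ≤ n
  u≤n {zero}  u≰s _   = z≤n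
  u≤n {suc u} u≰s run = proj₁ (run u (s≤s⁻¹ (≰⇒> u≰s)) ≤-refl)

count-⊎ : (P? : Decidable P) (Q? : Decidable Q) (R? : Decidable R) → ∀ n →
          (∀ i → i < n → P i ⇔ (Q i ⊎ R i)) → (∀ i → i < n → Q i → ¬ R i) →
          count Q? n + count R? n ≡ count P? n
count-⊎ P? Q? R? zero    split disj = refl
count-⊎ P? Q? R? (suc n) split disj
  with P? n | Q? n | R? n
     | count-⊎ P? Q? R? n (λ i i<n → split i (m<n⇒m<1+n i<n)) (λ i i<n → disj i (m<n⇒m<1+n i<n))
... | _     | yes q | yes r | _  = contradiction r (disj n ≤-refl q)
... | yes _ | yes _ | no _  | ih = cong suc ih
... | yes _ | no _  | yes _ | ih = trans (+-suc _ _) (cong suc ih)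
... | yes p | no ¬q | no ¬r | _  with Equivalence.to (split n ≤-refl) p
...   | inj₁ q = contradiction q ¬q
...   | inj₂ r = contradiction r ¬r
count-⊎ P? Q? R? (suc n) split disj
    | no ¬p | yes q | no _  | _  = contradiction (Equivalence.from (split n ≤-refl) (inj₁ q)) ¬p
count-⊎ P? Q? R? (suc n) split disj
    | no ¬p | no _  | yes r | _  = contradiction (Equivalence.from (split n ≤-refl) (inj₂ r)) ¬p
count-⊎ P? Q? R? (suc n) split disj
    | no _  | no _  | no _  | ih = ih

count-∁ : (P? : Decidable P) → ∀ n → count P? n + count (¬? ∘ P?) n ≡ n
count-∁ P? zero = refl
count-∁ P? (suc n) with P? n
... | yes _ = cong suc (count-∁ P? n)
... | no _  = trans (+-suc _ _) (cong suc (count-∁ P? n))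

count-reverse : (P? : Decidable P) → ∀ n → count (λ i → P? (n ∸ suc i)) n ≡ count P? n
count-reverse P? zero    = refl
count-reverse P? (suc n) = begin
  count (λ i → P? (n ∸ i)) (1 + n)                                    ≡⟨ count-+ (λ i → P? (n ∸ i)) 1 n ⟩
  count (λ i → P? (n ∸ i)) 1 + count (λ i → P? (n ∸ suc i)) n         ≡⟨ cong (count (λ i → P? (n ∸ i)) 1 +_) (count-reverse P? n) ⟩
  count (λ i → P? (n ∸ i)) 1 + count P? n                             ≡⟨ last ⟩
  count P? (suc n)                                                    ∎
  where
  open ≡-Reasoning
  last : count (λ i → P? (n ∸ i)) 1 + count P? n ≡ count P? (suc n)
  last with P? n
  ... | yes _ = refl
  ... | no _  = refl

-- Passing from `w` to `suc w` drops the term at index 0 and gains the term at index `n`, which has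
-- the same residue.
count-rotate : ∀ n .{{_ : NonZero n}} (P? : Decidable P) → ∀ w →
               count (λ i → P? ((w + i) % n)) n ≡ count P? n
count-rotate {P} n P? zero    = count-cong _ P? n λ i i<n →
  mk⇔ (subst P (m<n⇒m%n≡m i<n)) (subst P (sym (m<n⇒m%n≡m i<n)))
count-rotate {P} n P? (suc w) = trans shift (count-rotate n P? w)
  where
  open ≡-Reasoning
  W? : Decidable (λ i → P ((w + i) % n))
  W? i = P? ((w + i) % n)
  last≡first : (w + n) % n ≡ (w + 0) % n
  last≡first = trans ([m+n]%n≡m%n w n) (cong (_% n) (sym (+-identityʳ w)))
  ends : count (λ i → W? (n + i)) 1 ≡ count W? 1
  ends = count-cong (λ i → W? (n + i)) W? 1 λ { zero _ → mk⇔
    (subst P (trans (cong (λ z → (w + z) % n) (+-identityʳ n)) last≡first))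
    (subst P (sym (trans (cong (λ z → (w + z) % n) (+-identityʳ n)) last≡first)))
    ; (suc _) (s≤s ()) }
  shift : count (λ i → P? ((suc w + i) % n)) n ≡ count W? n
  shift = +-cancelˡ-≡ (count W? 1) _ _ (begin
    count W? 1 + count (λ i → P? ((suc w + i) % n)) n
      ≡⟨ cong (count W? 1 +_) (count-cong (λ i → P? ((suc w + i) % n)) (W? ∘ suc) n λ i _ →
           mk⇔ (subst P (cong (_% n) (sym (+-suc w i)))) (subst P (cong (_% n) (+-suc w i)))) ⟩
    count W? 1 + count (W? ∘ suc) n           ≡⟨ count-+ W? 1 n ⟨
    count W? (1 + n)                          ≡⟨ cong (count W?) (+-comm 1 n) ⟩
    count W? (n + 1)                          ≡⟨ count-+ W? n 1 ⟩
    count W? n + count (λ i → W? (n + i)) 1   ≡⟨ cong (count W? n +_) ends ⟩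
    count W? n + count W? 1                   ≡⟨ +-comm (count W? n) _ ⟩
    count W? 1 + count W? n                   ∎)

count<⇒missing : (P? : Decidable P) → ∀ n → count P? n < n → ∃[ w ] (w < n × ¬ P w)
count<⇒missing P? (suc n) lt with P? n
... | no ¬p = n , ≤-refl , ¬p
... | yes _ with count<⇒missing P? n (s≤s⁻¹ lt)
...   | w , w<n , ¬p = w , m<n⇒m<1+n w<n , ¬p

count-blocks-mono : (P? : Decidable P) (Q? : Decidable Q) → ∀ a h →
  (∀ k → count (λ i → P? (k * a + i)) a ≤ count (λ i → Q? (k * a + i)) a) →
  count P? (h * a) ≤ count Q? (h * a)
count-blocks-mono P? Q? a zero    blk = z≤n
count-blocks-mono P? Q? a (suc h) blk = begin
  count P? (a + h * a)                                   ≡⟨ cong (count P?) (+-comm a _) ⟩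
  count P? (h * a + a)                                   ≡⟨ count-+ P? (h * a) a ⟩
  count P? (h * a) + count (λ i → P? (h * a + i)) a      ≤⟨ +-mono-≤ (count-blocks-mono P? Q? a h blk) (blk h) ⟩
  count Q? (h * a) + count (λ i → Q? (h * a + i)) a      ≡⟨ count-+ Q? (h * a) a ⟨
  count Q? (h * a + a)                                   ≡⟨ cong (count Q?) (+-comm a _) ⟨
  count Q? (a + h * a)                                   ∎
  where open ≤-Reasoning

-- The largest `p` satisfying `P` yields the `suc k` elements `p, …, p + k` of `Q`, and each smaller
-- one yields itself. The bound may fail for empty `P`, whence the alternative.
count-dilate-up : (P? : Decidable P) (Q? : Decidable Q) → ∀ k n N →
  (∀ p → p < n → P p → p + k < N × (∀ i → i ≤ k → Q (p + i))) →
  count P? n ≡ 0 ⊎ count P? n + k ≤ count Q? N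
count-dilate-up P? Q? k zero    N dil = inj₁ refl
count-dilate-up {Q = Q} P? Q? k (suc n) N dil with P? n
... | no _  = count-dilate-up P? Q? k n N λ p p<n → dil p (m<n⇒m<1+n p<n)
... | yes p = inj₂ (begin
  suc (count P? n) + k                                      ≤⟨ +-monoˡ-≤ k (s≤s (count-mono P? Q? n P⇒Q)) ⟩
  suc (count Q? n) + k                                      ≡⟨ +-suc (count Q? n) k ⟨
  count Q? n + suc k                                        ≡⟨ cong (count Q? n +_) (count-all (λ i → Q? (n + i)) (suc k) λ i i≤k → proj₂ (dil n ≤-refl p) i (s≤s⁻¹ i≤k)) ⟨
  count Q? n + count (λ i → Q? (n + i)) (suc k)             ≡⟨ count-+ Q? n (suc k) ⟨
  count Q? (n + suc k)                                      ≤⟨ count-monoʳ Q? (subst (_≤ N) (sym (+-suc n k)) (proj₁ (dil n ≤-refl p))) ⟩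
  count Q? N                                                ∎)
  where
  open ≤-Reasoning
  P⇒Q : ∀ i → i < n → _ → Q i
  P⇒Q i i<n Pi = subst Q (+-identityʳ i) (proj₂ (dil i (m<n⇒m<1+n i<n) Pi) 0 z≤n)

-- Mirror image of `count-dilate-up`: the least `p` satisfying `P` yields `p ∸ k, …, p`, and each
-- later one yields itself.
count-dilate-down : (P? : Decidable P) (Q? : Decidable Q) → ∀ k n →
  (∀ p → p < n → P p → k ≤ p × (∀ i → i ≤ k → Q (p ∸ i))) →
  count P? n ≡ 0 ⊎ count P? n + k ≤ count Q? n
count-dilate-down P? Q? k zero    dil = inj₁ refl
count-dilate-down {Q = Q} P? Q? k (suc n) dil
  with P? n | count-dilate-down P? Q? k n (λ p p<n → dil p (m<n⇒m<1+n p<n))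
... | no _  | inj₁ none = inj₁ none
... | no _  | inj₂ le   = inj₂ (≤-trans le (count-monoʳ Q? (n≤1+n n)))
-- Here `n` is the least number satisfying `P`, and the interval from `n ∸ k` to `n` supplies the
-- whole bound.
... | yes p | inj₁ none = inj₂ (begin
  suc (count P? n) + k   ≡⟨ cong (λ c → suc c + k) none ⟩
  suc k                  ≡⟨ m∸[m∸n]≡n (s≤s k≤n) ⟨
  suc n ∸ (suc n ∸ suc k)  ≤⟨ count-interval Q? (n ∸ k) (suc n) (suc n) run ⟩
  count Q? (suc n)       ∎)
  where
  open ≤-Reasoning
  k≤n = proj₁ (dil n ≤-refl p)
  run : ∀ z → n ∸ k ≤ z → z < suc n → z < suc n × Q z
  run z n∸k≤z z<1+n = z<1+n ,
    subst Q (m∸[m∸n]≡n (s≤s⁻¹ z<1+n)) (proj₂ (dil n ≤-refl p) (n ∸ z)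
      (subst (n ∸ z ≤_) (m∸[m∸n]≡n k≤n) (∸-monoʳ-≤ n n∸k≤z)))
... | yes p | inj₂ le with Q? n
...   | yes _ = inj₂ (s≤s le)
...   | no ¬q = contradiction (proj₂ (dil n ≤-refl p) 0 z≤n) ¬q

-- Counts as cardinalities.

HasCard-unique : ∀ {X p q} → HasCard X p → HasCard X q → p ≡ q
HasCard-unique (xs , xs! , xs⇔ , refl) (ys , ys! , ys⇔ , refl) =
  ↭-length (∼bag⇒↭ (unique∧set⇒bag xs! ys! λ {x} → ⇔-trans (xs⇔ x) (⇔-sym (ys⇔ x))))

count-HasCard : (P? : Decidable P) → ∀ n → (∀ x → P x → x < n) → HasCard P (count P? n)
count-HasCard P? n bounded =
  filter P? (downFrom n) , Unique.filter⁺ P? (Unique.downFrom⁺ n) ,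
  (λ x → mk⇔ (λ x∈ → proj₂ (∈-filter⁻ P? {xs = downFrom n} x∈))
             (λ p → ∈-filter⁺ P? (∈-downFrom⁺ (bounded x p)) p)) ,
  refl

-- A number below `n ∸ o` makes this difference positive, so the subtraction is not truncated.
m<n∸o⇒m+o<n : ∀ {m n o} → m < n ∸ o → m + o < n
m<n∸o⇒m+o<n {m} {n} {o} m<n∸o =
  m≤o∸n⇒m+n≤o (suc m) (<⇒≤ (m∸n≢0⇒n<m λ n∸o≡0 → n≮0 (subst (m <_) n∸o≡0 m<n∸o))) m<n∸o

-- Arithmetic of the semigroup generated by an interval.

module IntervalSemigroup (a b : ℕ) (0<b : 0 < b) (b<a : b < a) where

  S : ℕSet
  S = intervalSemigroup a b

  0<a : 0 < a
  0<a = <-trans 0<b b<a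

  instance
    a≢0 : NonZero a
    a≢0 = >-nonZero 0<a

    a+b≢0 : NonZero (a + b)
    a+b≢0 = >-nonZero (<-≤-trans 0<a (m≤m+n a b))

  -- Induction on the number of generators: if `k` of them can absorb the excess `i`, the new one is
  -- `a`; otherwise they take the maximal excess `k * b` and the new one takes the rest, at most
  -- `b`.
  S⁺ : ∀ k i → i ≤ k * b → S (k * a + i)
  S⁺ zero    zero _ = zero
  S⁺ (suc k) i i≤ with i ≤? k * b
  ... | yes i≤kb = subst S (sym (+-assoc a (k * a) i))
                     (add (gen (≤-refl , m≤m+n a b)) (S⁺ k i i≤kb))
  ... | no  i≰kb = subst S eq (add (gen (m≤m+n a j , +-monoʳ-≤ a j≤b)) (S⁺ k (k * b) ≤-refl))
    where
    j = i ∸ k * b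
    j≤b : j ≤ b
    j≤b = m≤n+o⇒m∸n≤o i (k * b) (subst (i ≤_) (+-comm b (k * b)) i≤)
    eq : (a + j) + (k * a + k * b) ≡ (a + k * a) + i
    eq = begin
      (a + j) + (k * a + k * b)   ≡⟨ swap a j (k * a) (k * b) ⟩
      (a + k * a) + (j + k * b)   ≡⟨ cong ((a + k * a) +_) (m∸n+n≡m (<⇒≤ (≰⇒> i≰kb))) ⟩
      (a + k * a) + i             ∎
      where
      open ≡-Reasoning
      swap : ∀ p q r s → (p + q) + (r + s) ≡ (p + r) + (q + s)
      swap = solve-∀

  -- Together with `S⁺` this presents `S` as the union of the intervals from `k * a` to
  -- `k * a + k * b`.
  S⁻ : ∀ {x} → S x → ∃[ k ] ∃[ i ] (i ≤ k * b × x ≡ k * a + i)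
  S⁻ {x} (gen (a≤x , x≤a+b)) = 1 , x ∸ a ,
    subst (x ∸ a ≤_) (sym (*-identityˡ b)) (m≤n+o⇒m∸n≤o x a x≤a+b) ,
    trans (sym (m+[n∸m]≡n a≤x)) (cong (_+ (x ∸ a)) (sym (*-identityˡ a)))
  S⁻ zero = 0 , 0 , z≤n , refl
  S⁻ (add sx sy) with S⁻ sx | S⁻ sy
  ... | k , i , i≤ , refl | l , j , j≤ , refl = k + l , i + j ,
    subst (i + j ≤_) (sym (*-distribʳ-+ b k l)) (+-mono-≤ i≤ j≤) , rearrange k l i j a
    where
    rearrange : ∀ k l i j a → (k * a + i) + (l * a + j) ≡ (k + l) * a + (i + j)
    rearrange = solve-∀

  S? : Decidable S
  S? x = map′
    (λ { (k , _ , ka≤x , x≤) → subst S (m+[n∸m]≡n ka≤x)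
           (S⁺ k (x ∸ k * a) (m≤n+o⇒m∸n≤o x (k * a) x≤)) })
    from
    -- Since `a` is positive, `x` itself bounds the number `k` of generators.
    (anyUpTo? (λ k → (k * a ≤? x) ×-dec (x ≤? k * a + k * b)) (suc x))
    where
    from : S x → ∃[ k ] (k < suc x × (k * a ≤ x × x ≤ k * a + k * b))
    from sx with S⁻ sx
    ... | k , i , i≤ , refl =
      k , s≤s (≤-trans (m≤m*n k a) (m≤m+n _ i)) , m≤m+n _ i , +-monoʳ-≤ (k * a) i≤

  -- The bounds on `g` serve the descent in `Initial.gap`: `0 < g` makes it terminate, and
  -- `g ≤ a + b` keeps it inside the natural numbers.
  S-split : ∀ {s} → S s → s ≡ 0 ⊎ ∃[ g ] ∃[ s′ ] (S g × g ≤ a + b × 0 < g × S s′ × s ≡ g + s′)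
  S-split {s} (gen {g} (a≤g , g≤a+b)) = inj₂
    (g , 0 , gen (a≤g , g≤a+b) , g≤a+b , <-≤-trans 0<a a≤g , zero , sym (+-identityʳ g))
  S-split zero = inj₁ refl
  S-split (add {x} {y} sx sy) with S-split sx
  ... | inj₁ refl = S-split sy
  ... | inj₂ (g , s′ , sg , g≤ , 0<g , ss′ , refl) =
    inj₂ (g , s′ + y , sg , g≤ , 0<g , add ss′ sy , +-assoc g s′ y)

  -- The sets `Below` and `Gap` of a bounded set `A`, with the base point moved to 0.

  module Divisors (A : ℕSet) (A? : Decidable A) (B : ℕ) (bounded : ∀ x → A x → x < B) where

    Below : ℕSet
    Below x = ∃[ s ] (S s × A (x + s))

    Below? : Decidable Below
    Below? x = map′ (λ { (s , _ , p) → s , p })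
      (λ { (s , ss , As) → s , ≤-<-trans (m≤n+m s x) (bounded _ As) , ss , As })
      (anyUpTo? (λ s → S? s ×-dec A? (x + s)) B)

    -- This is `- y ∉ A - S`, written with sums to stay within the natural numbers.
    Gap : ℕSet
    Gap y = ¬ (∃[ x ] (A x × S (x + y)))

    Gap? : Decidable Gap
    Gap? y = ¬? (map′ (λ { (x , _ , p) → x , p }) (λ { (x , Ax , p) → x , bounded x Ax , Ax , p })
      (anyUpTo? (λ x → A? x ×-dec S? (x + y)) B))

    A⊆Below : ∀ {x} → A x → Below x
    A⊆Below {x} Ax = 0 , zero , subst A (sym (+-identityʳ x)) Ax

    Below-down : ∀ {x s} → Below (x + s) → S s → Below x
    Below-down {x} {s} (s′ , ss′ , A′) ss = s + s′ , add ss ss′ , subst A (+-assoc x s s′) A′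

    -- With `x + s` in `A`, membership of `x + y` in `S` would carry over to `(x + s) + y`, which a
    -- gap forbids.
    Gap-Below : ∀ {x y} → Gap y → Below x → ¬ S (x + y)
    Gap-Below {x} {y} gap (s , ss , As) sxy =
      gap (x + s , As , subst S (rearrange s x y) (add ss sxy))
      where
      rearrange : ∀ s x y → s + (x + y) ≡ (x + s) + y
      rearrange = solve-∀

    -- The successor leaves out `y = 0`: the block consists of `k * a + 1, …, k * a + a`.
    gapBlock : ℕ → ℕ
    gapBlock k = count (λ l → Gap? (suc (k * a + l))) a

    -- The new index `z` satisfies `y = suc k * a - z`, so that adding `z + i` to the gap gives
    -- `suc k * a + i`, which lies in `S` for `i ≤ suc k * b`.
    gapBlock-reverse : ∀ k → gapBlock k ≡ count (λ z → Gap? (k * a + (a ∸ z))) a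
    gapBlock-reverse k = trans
      (sym (count-reverse (λ l → Gap? (suc (k * a + l))) a))
      (count-cong (λ z → Gap? (suc (k * a + (a ∸ suc z)))) (λ z → Gap? (k * a + (a ∸ z))) a
        λ z z<a → mk⇔ (subst Gap (eq z<a)) (subst Gap (sym (eq z<a))))
      where
      eq : ∀ {z} → z < a → suc (k * a + (a ∸ suc z)) ≡ k * a + (a ∸ z)
      eq z<a = trans (sym (+-suc (k * a) _)) (cong (k * a +_) (sym (+-∸-assoc 1 z<a)))

    gapBlock-upper : A 0 → ∀ k →
      gapBlock k ≡ 0 ⊎ gapBlock k + suc k * b ≤ count (¬? ∘ Below?) (a + b)
    gapBlock-upper A0 k rewrite gapBlock-reverse k =
      count-dilate-up (λ z → Gap? (k * a + (a ∸ z))) (¬? ∘ Below?) (suc k * b) a (a + b) dil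
      where
      dil : ∀ z → z < a → Gap (k * a + (a ∸ z)) →
            z + suc k * b < a + b × (∀ i → i ≤ suc k * b → ¬ Below (z + i))
      dil z z<a gap = ≰⇒> fits , avoids
        where
        -- Otherwise `a ∸ z ≤ k * b`, so the supposed gap is itself in `S`, and `0 ∈ A` refutes it.
        fits : ¬ (a + b ≤ z + suc k * b)
        fits le = gap (0 , A0 , S⁺ k (a ∸ z) (m≤n+o⇒m∸n≤o a z
          (+-cancelʳ-≤ b _ _ (subst (a + b ≤_) (rearrange z b (k * b)) le))))
          where
          rearrange : ∀ z b kb → z + (b + kb) ≡ (z + kb) + b
          rearrange = solve-∀
        avoids : ∀ i → i ≤ suc k * b → ¬ Below (z + i)
        avoids i i≤ below = Gap-Below gap below (subst S (sym eq) (S⁺ (suc k) i i≤))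
          where
          rearrange : ∀ z i ka w → (z + i) + (ka + w) ≡ ((z + w) + ka) + i
          rearrange = solve-∀
          eq : (z + i) + (k * a + (a ∸ z)) ≡ suc k * a + i
          eq = trans (rearrange z i (k * a) (a ∸ z))
                 (cong (λ w → (w + k * a) + i) (m+[n∸m]≡n (<⇒≤ z<a)))

    -- Blocks of `Below` beyond the ground.

    belowBlock : ℕ → ℕ
    belowBlock k = count (λ i → Below? ((a + b) + (k * a + i))) a

    -- Modulo a + b, the elements of the shadow forced by a block element z are
    -- the consecutive residues z, z - 1, …, z - suc k * b.
    forced : ∀ k z → b ≤ z → z < a + b → Below (suc k * a + z) →
             ∀ i → i ≤ suc k * b → i ≤ z + (a + b) → Below ((z + (a + b) ∸ i) % (a + b))
    forced k z b≤z z<n below i i≤K i≤z+n with i ≤? z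
    ... | yes i≤z = subst Below (sym residue) (Below-down {z ∸ i} {suc k * a + i}
            (subst Below (sym eq) below) (S⁺ (suc k) i i≤K))
      where
      eq : z ∸ i + (suc k * a + i) ≡ suc k * a + z
      eq = trans (rearrange (z ∸ i) (suc k * a) i) (cong (suc k * a +_) (m∸n+n≡m i≤z))
        where
        rearrange : ∀ p q r → p + (q + r) ≡ q + (p + r)
        rearrange = solve-∀
      residue : (z + (a + b) ∸ i) % (a + b) ≡ z ∸ i
      residue = trans (cong (_% (a + b)) (+-∸-comm (a + b) i≤z))
        (trans ([m+n]%n≡m%n (z ∸ i) (a + b)) (m<n⇒m%n≡m (≤-<-trans (m∸n≤m z i) z<n)))
    -- The residue wraps around to `z + (a + b) - i`; the wrap uses up one generator `a + b` and
    -- leaves `k` generators with excess `i - b`.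
    ... | no i≰z = subst Below (sym residue) (Below-down {z + (a + b) ∸ i} {k * a + (i ∸ b)}
            (subst Below (sym eq) below) (S⁺ k (i ∸ b) (m≤n+o⇒m∸n≤o i b i≤K)))
      where
      z<i = ≰⇒> i≰z
      b≤i = ≤-trans b≤z (<⇒≤ z<i)
      eq : z + (a + b) ∸ i + (k * a + (i ∸ b)) ≡ suc k * a + z
      eq = +-cancelʳ-≡ b _ _ (begin
        z + (a + b) ∸ i + (k * a + (i ∸ b)) + b   ≡⟨ rearrange₁ (z + (a + b) ∸ i) (k * a) (i ∸ b) b ⟩
        k * a + (z + (a + b) ∸ i + (i ∸ b + b))   ≡⟨ cong (λ j → k * a + (z + (a + b) ∸ i + j)) (m∸n+n≡m b≤i) ⟩
        k * a + (z + (a + b) ∸ i + i)             ≡⟨ cong (k * a +_) (m∸n+n≡m i≤z+n) ⟩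
        k * a + (z + (a + b))                     ≡⟨ rearrange₂ (k * a) z a b ⟩
        suc k * a + z + b                         ∎)
        where
        open ≡-Reasoning
        rearrange₁ : ∀ p q r s → p + (q + r) + s ≡ q + (p + (r + s))
        rearrange₁ = solve-∀
        rearrange₂ : ∀ q z a b → q + (z + (a + b)) ≡ a + q + z + b
        rearrange₂ = solve-∀
      residue : (z + (a + b) ∸ i) % (a + b) ≡ z + (a + b) ∸ i
      residue = m<n⇒m%n≡m (m<n+o⇒m∸n<o (z + (a + b)) i (+-monoˡ-< (a + b) z<i))

    -- Cut the cycle of residues at an element w missing from the shadow.
    belowBlock-upper : ∀ t → count Below? (a + b) ≤ t → t < a + b → ∀ k →
                       belowBlock k ≤ t ∸ suc k * b
    belowBlock-upper t T≤t t<n k with count<⇒missing Below? (a + b) (≤-<-trans T≤t t<n)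
    ... | w , w<n , w∉T = begin
      belowBlock k               ≤⟨ count-mono _ (λ i → Z? (b + i)) a toZ ⟩
      count (λ i → Z? (b + i)) a ≤⟨ m≤n+m _ (count Z? b) ⟩
      count Z? b + count (λ i → Z? (b + i)) a  ≡⟨ count-+ Z? b a ⟨
      count Z? (b + a)           ≡⟨ cong (count Z?) (+-comm b a) ⟩
      count Z? n                 ≡⟨ count-rotate n Z? w ⟨
      count (λ p → Z? ((w + p) % n)) n ≤⟨ bound (count-dilate-down (λ p → Z? ((w + p) % n)) (λ p → Below? ((w + p) % n)) K n dil) ⟩
      t ∸ K                      ∎
      where
      open ≤-Reasoning
      n = a + b
      K = suc k * b
      -- `Z` indexes the block by residues: `b + i` stands for the block element at `i`, because `(a
      -- + b) + (k * a + i) = (a + k * a) + (b + i)`.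
      Z : ℕSet
      Z z = b ≤ z × Below (suc k * a + z)
      Z? : Decidable Z
      Z? z = (b ≤? z) ×-dec Below? (suc k * a + z)
      toZ : ∀ i → i < a → Below ((a + b) + (k * a + i)) → Z (b + i)
      toZ i _ below = m≤m+n b i , subst Below (rearrange a b (k * a) i) below
        where
        rearrange : ∀ a b q i → (a + b) + (q + i) ≡ (a + q) + (b + i)
        rearrange = solve-∀
      bound : ∀ {x} → x ≡ 0 ⊎ x + K ≤ count (λ p → Below? ((w + p) % n)) n → x ≤ t ∸ K
      bound (inj₁ refl) = z≤n
      bound (inj₂ le)   = m+n≤o⇒m≤o∸n _
        (≤-trans le (≤-trans (≤-reflexive (count-rotate n Below? w)) T≤t))
      dil : ∀ p → p < n → Z ((w + p) % n) →
            K ≤ p × (∀ i → i ≤ K → Below ((w + (p ∸ i)) % n))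
      dil p p<n (b≤z , below) = <⇒≤ K<p , λ i i≤K → cover i i≤K (≤-trans i≤K (<⇒≤ K<p))
        where
        z = (w + p) % n
        unwrap : ∀ i → i ≤ p → (z + n ∸ i) % n ≡ (w + (p ∸ i)) % n
        unwrap i i≤p with w + p <? n
        ... | yes w+p<n = begin-equality
          (z + n ∸ i) % n        ≡⟨ cong (λ x → (x + n ∸ i) % n) (m<n⇒m%n≡m w+p<n) ⟩
          (w + p + n ∸ i) % n    ≡⟨ cong (_% n) (+-∸-comm n (≤-trans i≤p (m≤n+m p w))) ⟩
          (w + p ∸ i + n) % n    ≡⟨ [m+n]%n≡m%n (w + p ∸ i) n ⟩
          (w + p ∸ i) % n        ≡⟨ cong (_% n) (+-∸-assoc w i≤p) ⟩
          (w + (p ∸ i)) % n      ∎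
        ... | no w+p≮n = begin-equality
          (z + n ∸ i) % n        ≡⟨ cong (λ x → (x ∸ i) % n) z+n≡w+p ⟩
          (w + p ∸ i) % n        ≡⟨ cong (_% n) (+-∸-assoc w i≤p) ⟩
          (w + (p ∸ i)) % n      ∎
          where
          n≤w+p = ≮⇒≥ w+p≮n
          z≡ : z ≡ w + p ∸ n
          z≡ = begin-equality
            (w + p) % n            ≡⟨ cong (_% n) (m∸n+n≡m n≤w+p) ⟨
            (w + p ∸ n + n) % n    ≡⟨ [m+n]%n≡m%n (w + p ∸ n) n ⟩
            (w + p ∸ n) % n        ≡⟨ m<n⇒m%n≡m (m<n+o⇒m∸n<o (w + p) n (+-mono-< w<n p<n)) ⟩
            w + p ∸ n              ∎
          z+n≡w+p : z + n ≡ w + p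
          z+n≡w+p = trans (cong (_+ n) z≡) (m∸n+n≡m n≤w+p)
        cover : ∀ i → i ≤ K → i ≤ p → Below ((w + (p ∸ i)) % n)
        cover i i≤K i≤p = subst Below (unwrap i i≤p)
          (forced k z b≤z (m%n<n (w + p) n) below i i≤K
            (≤-trans i≤p (≤-trans (<⇒≤ p<n) (m≤n+m n z))))
        -- If `p ≤ K`, the run back from position `p` would reach position 0, which is the missing
        -- element `w`.
        K<p : K < p
        K<p = ≰⇒> λ p≤K → w∉T (subst Below
          (trans (cong (λ x → (w + x) % n) (n∸n≡0 p))
            (trans (cong (_% n) (+-identityʳ w)) (m<n⇒m%n≡m w<n)))
          (cover p p≤K ≤-refl))

    -- Lower bounds on the blocks of a closed set whose shadow ends at `t`.

    module Initial (closed : ∀ x s → A (x + s) → S s → A x)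
                   (t : ℕ) (t<n : t < a + b) (shadow : ∀ x → x < a + b → A x → x ≤ t) where

      -- Suppose `x ∈ A` and `x + y ∈ S`. Splitting a generator off `x + y` and subtracting it from
      -- `x` keeps both conditions, until `x < a + b` and hence `x ≤ t < z`. Then
      -- `x + y = j * a + i`, where `j > k` forces `z ≤ x` and `j ≤ k` forces `a - z ≤ k * b`,
      -- against `fits`.
      gap : ∀ k z → t < z → z < a → z + suc k * b < a + b → Gap (k * a + (a ∸ z))
      gap k z t<z z<a fits (x , Ax , sxy) = descend x (<-wellFounded x) Ax sxy
        where
        y = k * a + (a ∸ z)
        z+[a∸z] = m+[n∸m]≡n (<⇒≤ z<a)
        descend : ∀ x → Acc _<_ x → A x → ¬ S (x + y)
        descend x (acc rs) Ax sxy with x <? a + b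
        descend x (acc rs) Ax sxy | no x≮n with S-split sxy
        ... | inj₁ x+y≡0 = contradiction (≤-<-trans z≤n (<-≤-trans t<n (≮⇒≥ x≮n)))
                             (λ 0<x → <⇒≢ (<-≤-trans 0<x (m≤m+n x y)) (sym x+y≡0))
        ... | inj₂ (g , s′ , sg , g≤n , 0<g , ss′ , eq) =
          descend (x ∸ g) (rs (∸-monoʳ-< 0<g g≤x))
            (closed (x ∸ g) g (subst A (sym (m∸n+n≡m g≤x)) Ax) sg)
            (subst S (+-cancelˡ-≡ g _ _ eq′) ss′)
          where
          g≤x = ≤-trans g≤n (≮⇒≥ x≮n)
          eq′ : g + s′ ≡ g + (x ∸ g + y)
          eq′ = trans (sym eq) (trans (cong (_+ y) (sym (m+[n∸m]≡n g≤x))) (+-assoc g (x ∸ g) y))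
        descend x (acc rs) Ax sxy | yes x<n with S⁻ sxy
        ... | j , i , i≤ , eq with j ≤? k
        ...   | no j≰k = <⇒≱ (≤-<-trans (shadow x x<n Ax) t<z) (+-cancelʳ-≤ (k * a + (a ∸ z)) z x (begin
          z + (k * a + (a ∸ z))    ≡⟨ rearrange z (k * a) (a ∸ z) ⟩
          (z + (a ∸ z)) + k * a    ≡⟨ cong (_+ k * a) z+[a∸z] ⟩
          suc k * a                ≤⟨ *-monoˡ-≤ a (≰⇒> j≰k) ⟩
          j * a                    ≤⟨ m≤m+n (j * a) i ⟩
          j * a + i                ≡⟨ eq ⟨
          x + (k * a + (a ∸ z))    ∎))
          where
          open ≤-Reasoning
          rearrange : ∀ z q w → z + (q + w) ≡ (z + w) + q
          rearrange = solve-∀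
        ...   | yes j≤k = <⇒≱ fits (begin
          a + b                    ≡⟨ cong (_+ b) z+[a∸z] ⟨
          z + (a ∸ z) + b          ≤⟨ +-monoˡ-≤ b (+-monoʳ-≤ z a∸z≤kb) ⟩
          z + k * b + b            ≡⟨ rearrange z (k * b) b ⟩
          z + suc k * b            ∎)
          where
          open ≤-Reasoning
          rearrange : ∀ z q b → z + q + b ≡ z + (b + q)
          rearrange = solve-∀
          a∸z≤kb : a ∸ z ≤ k * b
          a∸z≤kb = +-cancelˡ-≤ (k * a) _ _ (begin
            k * a + (a ∸ z)        ≤⟨ m≤n+m _ x ⟩
            x + (k * a + (a ∸ z))  ≡⟨ eq ⟩
            j * a + i              ≤⟨ +-mono-≤ (*-monoˡ-≤ a j≤k) (≤-trans i≤ (*-monoˡ-≤ b j≤k)) ⟩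
            k * a + k * b          ∎)

      gapBlock-lower : ∀ k → (a + b ∸ suc k * b) ∸ suc t ≤ gapBlock k
      gapBlock-lower k rewrite gapBlock-reverse k =
        count-interval _ (suc t) (a + b ∸ suc k * b) a λ z t<z z<u →
          z<a z<u , gap k z t<z (z<a z<u) (m<n∸o⇒m+o<n z<u)
        where
        z<a : ∀ {z} → z < a + b ∸ suc k * b → z < a
        z<a z<u = <-≤-trans z<u (m≤n+o⇒m∸n≤o (a + b) (suc k * b)
          (≤-trans (+-monoʳ-≤ a (m≤m+n b (k * b))) (≤-reflexive (+-comm a _))))

      -- Row `suc k` of the hypothesis at `b + i` is index `i` of the `k`-th block, so the block
      -- contains the range `k * b ≤ i < t ∸ b`.
      belowBlock-lower : (∀ k i → k * b ≤ i → i < t → A (k * a + i)) → ∀ k →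
                         t ∸ suc k * b ≤ belowBlock k
      belowBlock-lower runs k = subst (_≤ belowBlock k) (∸-+-assoc t b (k * b))
        (count-interval _ (k * b) (t ∸ b) a λ i kb≤i i<t∸b →
          <-≤-trans i<t∸b (m≤n+o⇒m∸n≤o t b (≤-trans (<⇒≤ t<n) (≤-reflexive (+-comm a b)))) ,
          A⊆Below (subst A (rearrange a b (k * a) i)
            (runs (suc k) (b + i) (+-monoʳ-≤ b kb≤i) (b+i<t i<t∸b))))
        where
        rearrange : ∀ a b q i → (a + q) + (b + i) ≡ (a + b) + (q + i)
        rearrange = solve-∀
        b+i<t : ∀ {i} → i < t ∸ b → b + i < t
        b+i<t {i} i<t∸b = subst (_< t) (+-comm i b) (m<n∸o⇒m+o<n i<t∸b)

-- Finite sets given by enumerations.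

HasCard⇒decidable : ∀ {X r} → HasCard X r → Decidable X
HasCard⇒decidable (xs , _ , xs⇔ , _) x =
  map′ (Equivalence.to (xs⇔ x)) (Equivalence.from (xs⇔ x)) (x ∈? xs)

HasCard⇒bounded : ∀ {X r} → HasCard X r → ∃[ u ] (∀ x → X x → x < u)
HasCard⇒bounded (xs , _ , xs⇔ , _) =
  suc (max 0 xs) , λ x Xx → s≤s (All.lookup (xs≤max 0 xs) (Equivalence.from (xs⇔ x) Xx))

HasCard⇒least : ∀ {X r} → HasCard X (suc r) → ∃[ e ] IsLeast X e
HasCard⇒least (x ∷ xs , _ , xs⇔ , _) = min x xs , min∈ , λ y Xy → min≤ (Equivalence.from (xs⇔ y) Xy)
  where
  min∈ : _
  min∈ with argmin-sel id x xs
  ... | inj₁ eq = Equivalence.to (xs⇔ _) (here eq)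
  ... | inj₂ m∈ = Equivalence.to (xs⇔ _) (there m∈)
  min≤ : ∀ {y} → _ → min x xs ≤ y
  min≤ (here refl) = min≤v⁺ x xs (inj₁ ≤-refl)
  min≤ (there y∈)  = All.lookup (min≤xs x xs) y∈

HasCard-∪｛｝ : ∀ {X r s} → HasCard X r → ¬ X s → HasCard (X ∪ ｛ s ｝) (suc r)
HasCard-∪｛｝ {X} {s = s} (xs , xs! , xs⇔ , len) s∉X = s ∷ xs ,
  All.tabulate (λ { x∈ refl → s∉X (Equivalence.to (xs⇔ _) x∈) }) ∷ xs! ,
  (λ x → mk⇔ to (from x)) ,
  cong suc len
  where
  to : ∀ {x} → _ → (X ∪ ｛ s ｝) x
  to (here refl) = inj₂ refl
  to (there x∈)  = inj₁ (Equivalence.to (xs⇔ _) x∈)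
  from : ∀ x → (X ∪ ｛ s ｝) x → _
  from x (inj₁ Xx)   = there (Equivalence.from (xs⇔ x) Xx)
  from x (inj₂ refl) = here refl

HasCard-inhabited : ∀ {X r x} → HasCard X r → X x → ∃[ r′ ] r ≡ suc r′
HasCard-inhabited {x = x} (xs , _ , xs⇔ , refl) Xx with xs | Equivalence.from (xs⇔ x) Xx
... | _ ∷ _ | _ = _ , refl

-- For `q ≥ 0` the number `j` is the remainder of `u`. A negative quotient is impossible: moving it
-- to the other side makes `j` at least `a`.
Position⇒≮ : ∀ a b m u q j .{{_ : NonZero a}} → j < a → Position a b m (m + b + u) q j → ¬ (u % a < j)
Position⇒≮ a b m u q j j<a pos = go q (trans (sym offset) pos)
  where
  offset : (ℤ.+ (m + b + u)) ℤ.- (ℤ.+ (m + b)) ≡ ℤ.+ u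
  offset = trans (ℤ.m-n≡m⊖n (m + b + u) (m + b))
    (trans (ℤ.⊖-≥ (m≤m+n (m + b) u)) (cong ℤ.+_ (m+n∸m≡n (m + b) u)))
  go : ∀ q → ℤ.+ u ≡ q ℤ.* ℤ.+ a ℤ.+ ℤ.+ j → ¬ (u % a < j)
  go (ℤ.+ q) eq = λ lt → <⇒≢ lt (begin
    u % a           ≡⟨ cong (_% a) (ℤ.+-injective (trans eq (cong (ℤ._+ ℤ.+ j) (sym (ℤ.pos-* q a))))) ⟩
    (q * a + j) % a ≡⟨ cong (_% a) (+-comm (q * a) j) ⟩
    (j + q * a) % a ≡⟨ [m+kn]%n≡m%n j q a ⟩
    j % a           ≡⟨ m<n⇒m%n≡m j<a ⟩
    j               ∎)
    where open ≡-Reasoning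
  go (ℤ.-[1+ q ]) eq = contradiction j<a (≤⇒≯ (begin
    a               ≤⟨ m≤m+n a (q * a) ⟩
    suc q * a       ≤⟨ m≤n+m (suc q * a) u ⟩
    u + suc q * a   ≡⟨ ℤ.+-injective eqℤ ⟩
    j               ∎))
    where
    open ≤-Reasoning
    cancel : ∀ x y z → (ℤ.- x ℤ.* y ℤ.+ z) ℤ.+ x ℤ.* y ≡ z
    cancel = ℤ-Solver.solve-∀
    eqℤ : ℤ.+ (u + suc q * a) ≡ ℤ.+ j
    eqℤ = trans (cong₂ ℤ._+_ eq (ℤ.pos-* (suc q) a)) (cancel (ℤ.+ suc q) (ℤ.+ a) (ℤ.+ j))

-- Comparison of a closed set with an arbitrary configuration.

module Comparison (a b : ℕ) (0<b : 0 < b) (b<a : b < a) where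

  open IntervalSemigroup a b 0<b b<a

  module _
    {A : ℕSet} (A? : Decidable A) {N : ℕSet} (N? : Decidable N) (h : ℕ)
    (A-bounded : ∀ x → A x → x < (a + b) + h * a) (N-bounded : ∀ x → N x → x < (a + b) + h * a)
    where

    private
      n = a + b
      module DA = Divisors A A? (n + h * a) A-bounded
      module DN = Divisors N N? (n + h * a) N-bounded

    module _
      (closed : ∀ x s → A (x + s) → S s → A x) (t : ℕ) (t<n : t < n)
      (shadow : ∀ x → x < n → A x → x ≤ t) (initial : ∀ x → x ≤ t → A x)
      (runs : ∀ k i → k * b ≤ i → i < t → A (k * a + i))
      (A≤N : count DA.Below? (n + h * a) ≤ count DN.Below? (n + h * a)) where

      private module I = DA.Initial closed t t<n shadow

      -- If `Below` of `N` had at most `t` elements in the ground, each of its blocks would be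
      -- bounded by the matching block of `A`, while the ground contributes at least `t + 1`
      -- elements for `A`. This contradicts `A≤N`.
      shadow-large : t < count DN.Below? n
      shadow-large = ≰⇒> λ small → <⇒≱ (begin-strict
        count DN.Below? (n + h * a)
          ≡⟨ count-+ DN.Below? n (h * a) ⟩
        count DN.Below? n + count (λ i → DN.Below? (n + i)) (h * a)
          ≤⟨ +-mono-≤ small (count-blocks-mono (λ i → DN.Below? (n + i)) (λ i → DA.Below? (n + i)) a h λ k →
               ≤-trans (DN.belowBlock-upper t small t<n k) (I.belowBlock-lower runs k)) ⟩
        t + count (λ i → DA.Below? (n + i)) (h * a)
          <⟨ +-monoˡ-< _ (count-interval DA.Below? 0 (suc t) n λ z _ z≤t →
               ≤-<-trans (s≤s⁻¹ z≤t) t<n , DA.A⊆Below (initial z (s≤s⁻¹ z≤t))) ⟩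
        count DA.Below? n + count (λ i → DA.Below? (n + i)) (h * a)
          ≡⟨ count-+ DA.Below? n (h * a) ⟨
        count DA.Below? (n + h * a) ∎) A≤N
        where open ≤-Reasoning

      -- By `shadow-large` at most `n - (t + 1)` elements of the ground avoid `Below` of `N`, so the
      -- upper bound on its gap blocks drops to the lower bound for `A`. The number of gap blocks is
      -- independent of the outer `h`.
      gaps-≤ : N 0 → ∀ h → count (DN.Gap? ∘ suc) (h * a) ≤ count (DA.Gap? ∘ suc) (h * a)
      gaps-≤ N0 h = count-blocks-mono (DN.Gap? ∘ suc) (DA.Gap? ∘ suc) a h λ k →
        ≤-trans (bound k (DN.gapBlock-upper N0 k)) (I.gapBlock-lower k)
        where
        open ≤-Reasoning
        bound : ∀ k {x} → x ≡ 0 ⊎ x + suc k * b ≤ count (¬? ∘ DN.Below?) n →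
                x ≤ n ∸ suc k * b ∸ suc t
        bound k (inj₁ refl)   = z≤n
        bound k {x} (inj₂ le) = m+n≤o⇒m≤o∸n x (m+n≤o⇒m≤o∸n (x + suc t) (begin
          x + suc t + suc k * b                            ≡⟨ rearrange x (suc t) (suc k * b) ⟩
          suc t + (x + suc k * b)                          ≤⟨ +-mono-≤ shadow-large le ⟩
          count DN.Below? n + count (¬? ∘ DN.Below?) n     ≡⟨ count-∁ DN.Below? n ⟩
          n                                                ∎))
          where
          rearrange : ∀ x y z → x + y + z ≡ y + (x + z)
          rearrange = solve-∀

  -- Divisors of a configuration, counted from its least element.

  module Shifted (c : ℕ) ([c,∞⟩⊆S : [ c ,∞⟩ ⊆ S) {X : ℕSet} (X? : Decidable X)
    (e : ℕ) (e-least : IsLeast X e) (2c-1≤e : 2 * c ∸ 1 ≤ e)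
    (B : ℕ) (bounded : ∀ x → X (e + x) → x < B) where

    A : ℕSet
    A x = X (e + x)

    A? : Decidable A
    A? x = X? (e + x)

    open Divisors A A? B bounded public

    A0 : A 0
    A0 = subst X (sym (+-identityʳ e)) (proj₁ e-least)

    c+c≤1+e : c + c ≤ suc e
    c+c≤1+e = subst (λ z → c + z ≤ suc e) (+-identityʳ c) (≤-trans (m≤n+m∸n (2 * c) 1) (s≤s 2c-1≤e))

    c≤e : c ≤ e
    c≤e = helper c c+c≤1+e
      where
      helper : ∀ c → c + c ≤ suc e → c ≤ e
      helper zero    _         = z≤n
      helper (suc c) (s≤s le) = ≤-trans (m≤n+m (suc c) c) le

    unshift : ∀ {y} → X y → A (y ∸ e)
    unshift {y} Xy = subst X (sym (m+[n∸m]≡n (proj₂ e-least y Xy))) Xy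

    X-bounded : ∀ y → X y → y < e + B
    X-bounded y Xy = subst (_< e + B) (m+[n∸m]≡n (proj₂ e-least y Xy)) (+-monoʳ-< e (bounded _ (unshift Xy)))

    card-shift : ∀ {r} → HasCard X r → r ≡ count A? B
    card-shift X-card = trans (HasCard-unique X-card (count-HasCard X? (e + B) X-bounded))
      (trans (count-+ X? e B) (cong (_+ count A? B)
        (count-none X? e λ i i<e Xi → <⇒≱ i<e (proj₂ e-least i Xi))))

    D∪? : Decidable (D∪ S X)
    D∪? α = map′ (λ { (x , _ , p) → x , p }) (λ { (x , Xx , p) → x , X-bounded x Xx , Xx , p })
      (anyUpTo? (λ x → X? x ×-dec (S? α ×-dec ((α ≤? x) ×-dec S? (x ∸ α)))) (e + B))

    D∪-card : HasCard (D∪ S X) (count D∪? (e + B))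
    D∪-card = count-HasCard D∪? (e + B)
      λ { α (x , Xx , _ , α≤x , _) → ≤-<-trans α≤x (X-bounded x Xx) }

    D∪-above : ∀ x → D∪ S X (e + x) ⇔ Below x
    D∪-above x = mk⇔ to from
      where
      to : D∪ S X (e + x) → Below x
      to (y , Xy , _ , e+x≤y , s) = y ∸ (e + x) , s ,
        subst X (trans (sym (m+[n∸m]≡n e+x≤y)) (+-assoc e x _)) Xy
      from : Below x → D∪ S X (e + x)
      from (s , ss , Xs) = e + (x + s) , Xs , [c,∞⟩⊆S (≤-trans c≤e (m≤m+n e x)) ,
        +-monoʳ-≤ e (m≤m+n x s) ,
        subst S (sym (trans (cong (_∸ (e + x)) (sym (+-assoc e x s))) (m+n∸m≡n (e + x) s))) ss

    Gap⇒<c : ∀ {y} → Gap y → y < c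
    Gap⇒<c gap = ≰⇒> λ c≤y → gap (0 , A0 , [c,∞⟩⊆S c≤y)

    -- An element of `S` below `e` that divides nothing in `X` gives a gap by definition. Conversely
    -- a gap is smaller than `c`, so `α ≥ e + 1 - c ≥ c`.
    S-below : ∀ α → α < e → S α ⇔ (D∪ S X α ⊎ Gap (e ∸ α))
    S-below α α<e = mk⇔ to from
      where
      open ≤-Reasoning
      to : S α → D∪ S X α ⊎ Gap (e ∸ α)
      to sα with D∪? α
      ... | yes d = inj₁ d
      ... | no ¬d = inj₂ λ { (x , Ax , s) → ¬d (e + x , Ax , sα , ≤-trans (<⇒≤ α<e) (m≤m+n e x) ,
              subst S (trans (+-comm x (e ∸ α)) (sym (+-∸-comm x (<⇒≤ α<e)))) s) }
      from : D∪ S X α ⊎ Gap (e ∸ α) → S α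
      from (inj₁ (_ , _ , sα , _)) = sα
      from (inj₂ gap) = [c,∞⟩⊆S (+-cancelʳ-≤ c c α (begin
        c + c               ≤⟨ c+c≤1+e ⟩
        suc e               ≡⟨ cong suc (m+[n∸m]≡n (<⇒≤ α<e)) ⟨
        suc (α + (e ∸ α))   ≡⟨ +-suc α (e ∸ α) ⟨
        α + suc (e ∸ α)     ≤⟨ +-monoʳ-≤ α (Gap⇒<c gap) ⟩
        α + c               ∎))

    D∪-Gap-disjoint : ∀ α → α < e → D∪ S X α → ¬ Gap (e ∸ α)
    D∪-Gap-disjoint α α<e (y , Xy , _ , _ , s) gap = gap (y ∸ e , unshift Xy , subst S eq s)
      where
      open ≡-Reasoning
      eq : y ∸ α ≡ (y ∸ e) + (e ∸ α)
      eq = begin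
        y ∸ α               ≡⟨ cong (_∸ α) (m∸n+n≡m (proj₂ e-least y Xy)) ⟨
        (y ∸ e + e) ∸ α     ≡⟨ +-∸-assoc (y ∸ e) (<⇒≤ α<e) ⟩
        (y ∸ e) + (e ∸ α)   ∎

    -- Below `e` the semigroup splits into divisors and gaps; from `e` on the divisors are `Below`.
    -- The gaps stand on the left to avoid a subtraction.
    D∪-count : count D∪? (e + B) + count (Gap? ∘ suc) e ≡ count S? e + count Below? B
    D∪-count = begin
      count D∪? (e + B) + count (Gap? ∘ suc) e
        ≡⟨ cong₂ _+_ (count-+ D∪? e B) gaps ⟩
      (count D∪? e + count (λ x → D∪? (e + x)) B) + count (λ α → Gap? (e ∸ α)) e
        ≡⟨ rearrange (count D∪? e) _ _ ⟩
      (count D∪? e + count (λ α → Gap? (e ∸ α)) e) + count (λ x → D∪? (e + x)) B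
        ≡⟨ cong₂ _+_ (count-⊎ S? D∪? (λ α → Gap? (e ∸ α)) e S-below D∪-Gap-disjoint)
                     (count-cong (λ x → D∪? (e + x)) Below? B λ x _ → D∪-above x) ⟩
      count S? e + count Below? B ∎
      where
      open ≡-Reasoning
      rearrange : ∀ x y z → (x + y) + z ≡ (x + z) + y
      rearrange = solve-∀
      gaps : count (Gap? ∘ suc) e ≡ count (λ α → Gap? (e ∸ α)) e
      gaps = trans (sym (count-reverse (Gap? ∘ suc) e))
        (count-cong (λ α → Gap? (suc (e ∸ suc α))) (λ α → Gap? (e ∸ α)) e λ α α<e →
          mk⇔ (subst Gap (sym (+-∸-assoc 1 α<e))) (subst Gap (+-∸-assoc 1 α<e)))

    Gap-support : ∀ y → e ≤ y → ¬ Gap (suc y)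
    Gap-support y e≤y gap = <⇒≱ (Gap⇒<c gap) (≤-trans c≤e (≤-trans e≤y (n≤1+n y)))

-- Elements that an ordered amenable set is forced to contain.

module Ordered (a b : ℕ) (0<b : 0 < b) (b<a : b < a) (c : ℕ)
  ([c,∞⟩⊆S : [ c ,∞⟩ ⊆ intervalSemigroup a b) {m r : ℕ} (c≤m : c ≤ m) {M : ℕSet}
  (oa : OrderedAmenable a b c m r M) where

  open IntervalSemigroup a b 0<b b<a
  open OrderedAmenable oa
  open Amenable amenable

  t : ℕ
  t = proj₁ shadow

  t<a+b : t < a + b
  t<a+b = <-≤-trans (proj₁ (proj₂ shadow)) (m∸n≤m (a + b) 1)

  initial : ∀ x → x ≤ t → M (m + x)
  initial x x≤t = proj₁ (proj₂ (proj₂ (proj₂ shadow)) (m≤m+n m x , +-monoʳ-≤ m x≤t))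

  shadow-≤ : ∀ x → x < a + b → M (m + x) → x ≤ t
  shadow-≤ x x<n Mx = +-cancelˡ-≤ m x t
    (proj₂ (proj₁ (proj₂ (proj₂ shadow)) (Mx , m≤m+n m x , ∸-monoˡ-≤ 1 m+x<)))
    where
    m+x< : suc (m + x) ≤ m + a + b
    m+x< = subst (m + x <_) (sym (+-assoc m a b)) (+-monoʳ-< m x<n)

  closed↓ : ∀ x s → M (m + (x + s)) → S s → M (m + x)
  closed↓ x s Mxs ss = closed (m + (x + s)) Mxs
    (([c,∞⟩⊆S (≤-trans c≤m (m≤m+n m x)) , +-monoʳ-≤ m (m≤m+n x s) ,
      subst S (sym (trans (cong (_∸ (m + x)) (sym (+-assoc m x s))) (m+n∸m≡n (m + x) s))) ss) ,
     m≤m+n m x)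

  M? : Decidable M
  M? = HasCard⇒decidable card

  -- A minimal missing element could be added to M, but it is not in the last
  -- wagon: its position i ∸ b is smaller than the position t ∸ b of m + t.
  runs : ∀ k i → k * b ≤ i → i < t → M (m + (k * a + i))
  runs k = go k (<-wellFounded k)
    where
    go : ∀ k → Acc _<_ k → ∀ i → k * b ≤ i → i < t → M (m + (k * a + i))
    go zero _ i _ i<t = initial i (<⇒≤ i<t)
    go (suc k) (acc rs) i kb≤i i<t with M? (m + (suc k * a + i))
    ... | yes Ms = Ms
    ... | no  s∉M = contradiction (ordered s s∈S s∉M extended same-shadow) (not-last isPivot)
      where
      s = m + (suc k * a + i)

      b≤i : b ≤ i
      b≤i = ≤-trans (m≤m+n b (k * b)) kb≤i

      b≤t : b ≤ t
      b≤t = ≤-trans b≤i (<⇒≤ i<t)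

      m≤s : m ≤ s
      m≤s = m≤m+n m _

      s∈S : S s
      s∈S = [c,∞⟩⊆S (≤-trans c≤m m≤s)

      -- A divisor `m + y′` of `s` differs from it by `j * a + l`. For `j = 0` it is `s`; up to
      -- `j = suc k` it lies in row `suc k - j` at index `i - l`, where induction applies; a larger
      -- `j` pushes `y′` down to at most `i`, inside the shadow.
      below : ∀ y′ j l → l ≤ j * b → suc k * a + i ≡ y′ + (j * a + l) → (M ∪ ｛ s ｝) (m + y′)
      below y′ zero zero _ eq = inj₂ (cong (m +_) (trans eq (+-identityʳ y′)))
      below y′ (suc j) l l≤ eq with suc j ≤? suc k
      ... | yes (s≤s j≤k) = inj₁ (subst (M ∘ (m +_)) (sym y′≡)
              (go k′ (rs (s≤s (m∸n≤m k j))) (i ∸ l) (m+n≤o⇒m≤o∸n (k′ * b) k′b+l≤i) (≤-<-trans (m∸n≤m i l) i<t)))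
        where
        k′ = k ∸ j
        split : ∀ x → suc k * x ≡ suc j * x + k′ * x
        split x = trans (cong (λ q → suc q * x) (sym (m+[n∸m]≡n j≤k))) (*-distribʳ-+ x (suc j) k′)
        k′b+l≤i : k′ * b + l ≤ i
        k′b+l≤i = begin
          k′ * b + l           ≤⟨ +-monoʳ-≤ (k′ * b) l≤ ⟩
          k′ * b + suc j * b   ≡⟨ +-comm (k′ * b) _ ⟩
          suc j * b + k′ * b   ≡⟨ split b ⟨
          suc k * b            ≤⟨ kb≤i ⟩
          i                    ∎
          where open ≤-Reasoning
        y′≡ : y′ ≡ k′ * a + (i ∸ l)
        y′≡ = +-cancelʳ-≡ (suc j * a + l) _ _ (begin
          y′ + (suc j * a + l)                    ≡⟨ eq ⟨
          suc k * a + i                           ≡⟨ cong (_+ i) (split a) ⟩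
          suc j * a + k′ * a + i                  ≡⟨ cong (suc j * a + k′ * a +_) (m∸n+n≡m (m+n≤o⇒n≤o (k′ * b) k′b+l≤i)) ⟨
          suc j * a + k′ * a + (i ∸ l + l)        ≡⟨ rearrange (suc j * a) (k′ * a) (i ∸ l) l ⟩
          k′ * a + (i ∸ l) + (suc j * a + l)      ∎)
          where
          open ≡-Reasoning
          rearrange : ∀ p q u v → p + q + (u + v) ≡ q + u + (p + v)
          rearrange = solve-∀
      ... | no j≰k = inj₁ (initial y′ (≤-trans y′≤i (<⇒≤ i<t)))
        where
        y′≤i : y′ ≤ i
        y′≤i = +-cancelˡ-≤ (suc k * a) y′ i (begin
          suc k * a + y′          ≤⟨ +-monoˡ-≤ y′ (*-monoˡ-≤ a (<⇒≤ (≰⇒> j≰k))) ⟩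
          suc j * a + y′          ≡⟨ +-comm _ y′ ⟩
          y′ + suc j * a          ≤⟨ +-monoʳ-≤ y′ (m≤m+n _ l) ⟩
          y′ + (suc j * a + l)    ≡⟨ eq ⟨
          suc k * a + i           ∎)
          where open ≤-Reasoning

      closed′ : ∀ x → (M ∪ ｛ s ｝) x → D S x ∩ [ m ,∞⟩ ⊆ M ∪ ｛ s ｝
      closed′ x (inj₁ Mx)   d                          = inj₁ (closed x Mx d)
      closed′ x (inj₂ refl) {y} ((_ , y≤s , sd) , m≤y) with S⁻ sd
      ... | j , l , l≤ , eq = subst (M ∪ ｛ s ｝) (m+[n∸m]≡n m≤y)
        (below (y ∸ m) j l l≤ (+-cancelˡ-≡ m _ _ (begin
          s                             ≡⟨ m+[n∸m]≡n y≤s ⟨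
          y + (s ∸ y)                   ≡⟨ cong₂ _+_ (sym (m+[n∸m]≡n m≤y)) eq ⟩
          m + (y ∸ m) + (j * a + l)     ≡⟨ +-assoc m (y ∸ m) _ ⟩
          m + (y ∸ m + (j * a + l))     ∎)))
        where open ≡-Reasoning

      extended : Amenable S c m (suc r) (M ∪ ｛ s ｝)
      extended = record
        { subset = λ { (inj₁ Mx) → subset Mx ; (inj₂ refl) → s∈S }
        ; card   = HasCard-∪｛｝ card s∉M
        ; bound  = bound
        ; least  = inj₁ (proj₁ least) , λ { x (inj₁ Mx) → proj₂ least x Mx ; x (inj₂ refl) → m≤s }
        ; closed = closed′
        }

      s∉Ground : ¬ Ground a b m s
      s∉Ground (_ , s≤) = <-irrefl refl (begin-strict
        m + a + b               ≡⟨ +-assoc m a b ⟩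
        m + (a + b)             ≤⟨ +-monoʳ-≤ m (+-mono-≤ (m≤m+n a (k * a)) b≤i) ⟩
        s                       ≤⟨ s≤ ⟩
        m + a + b ∸ 1           <⟨ ∸-monoʳ-< z<s (≤-trans 0<b (m≤n+m b (m + a))) ⟩
        m + a + b               ∎)
        where open ≤-Reasoning

      same-shadow : Shadow a b m (M ∪ ｛ s ｝) ≐ Shadow a b m M
      same-shadow = (λ { (inj₁ Mx , g) → Mx , g ; (inj₂ refl , g) → contradiction g s∉Ground }) ,
                    (λ { (Mx , g) → inj₁ Mx , g })

      not-last : IsPivot a b m M pivot → s ≢ pivot + a
      -- As `b ≤ t`, the element `m + t` of `M` already reaches `m + b`.
      not-last (_ , inj₁ (P<m+b , _ , P-max)) _ =
        <⇒≱ P<m+b (≤-trans (+-monoʳ-≤ m b≤t) (P-max (m + t) (initial t ≤-refl)))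
      -- From `s = P + a` the pivot is `m + b + u`, where `u` has remainder `i - b` modulo `a`. But
      -- `m + t` puts `t - b` into `J`, so this remainder is smaller than `j₀`.
      not-last (_ , inj₂ (j₀ , ((j₀<a , _) , j₀-max) , (_ , q , pos) , _)) s≡P+a =
        Position⇒≮ a b m u q j₀ j₀<a (subst (λ P → Position a b m P q j₀) P≡ pos)
          (subst (_< j₀) (sym u%a) (<-≤-trans (∸-monoˡ-< i<t b≤i) (j₀-max (t ∸ b) t∸b∈J)))
        where
        u = (i ∸ b) + k * a
        t∸b<a : t ∸ b < a
        t∸b<a = m<n+o⇒m∸n<o t b (subst (t <_) (+-comm a b) t<a+b)
        u%a : u % a ≡ i ∸ b
        u%a = trans ([m+kn]%n≡m%n (i ∸ b) k a)
          (m<n⇒m%n≡m (<-trans (∸-monoˡ-< i<t b≤i) t∸b<a))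
        P≡ : pivot ≡ m + b + u
        P≡ = +-cancelʳ-≡ a _ _ (begin
          pivot + a                           ≡⟨ s≡P+a ⟨
          m + (a + k * a + i)                 ≡⟨ cong (λ x → m + (a + k * a + x)) (m+[n∸m]≡n b≤i) ⟨
          m + (a + k * a + (b + (i ∸ b)))     ≡⟨ rearrange m a (k * a) b (i ∸ b) ⟩
          m + b + (i ∸ b + k * a) + a         ∎)
          where
          open ≡-Reasoning
          rearrange : ∀ m a q b w → m + (a + q + (b + w)) ≡ m + b + (w + q) + a
          rearrange = solve-∀
        t∸b∈J : J a b m M (t ∸ b)
        t∸b∈J = t∸b<a , m + t , 0 , initial t ≤-refl , (begin
          ℤ.+ (m + t) ℤ.- ℤ.+ (m + b)   ≡⟨ ℤ.m-n≡m⊖n (m + t) (m + b) ⟩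
          (m + t) ℤ.⊖ (m + b)           ≡⟨ ℤ.⊖-≥ (+-monoʳ-≤ m b≤t) ⟩
          ℤ.+ (m + t ∸ (m + b))         ≡⟨ cong ℤ.+_ ([m+n]∸[m+o]≡n∸o m t b) ⟩
          ℤ.+ (t ∸ b)                   ∎)
          where open ≡-Reasoning

-- Minimality of the number of divisors.

theorem4p28 : (a b c m r : ℕ) → 0 < b → b < a →
    IsConductor (intervalSemigroup a b) c → 2 * c ∸ 1 ≤ m →
    (M : ℕSet) → OrderedAmenable a b c m r M →
    OptimalConfiguration (intervalSemigroup a b) m r M
theorem4p28 a b c m r 0<b b<a ([c,∞⟩⊆S , _) 2c-1≤m M oa = record
  { configuration = M-configuration
  ; optimal       = δ , D∪M-card , (M , M-configuration , D∪M-card) , minimal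
  }
  where
  open OrderedAmenable oa using (amenable)
  open Amenable amenable
  open IntervalSemigroup a b 0<b b<a
  open Comparison a b 0<b b<a

  M-configuration : Configuration S m r M
  M-configuration = record { subset = λ Mx → subset Mx , proj₂ least _ Mx ; card = card }

  M? : Decidable M
  M? = HasCard⇒decidable card

  uM = proj₁ (HasCard⇒bounded card)

  -- The bound `B` stays a parameter: `δ` is fixed before the competitor `N` is known, while the
  -- comparison needs a bound valid for both sets. `HasCard-unique` identifies the two counts.
  module SM (B : ℕ) (bounded : ∀ x → M (m + x) → x < B) =
    Shifted c [c,∞⟩⊆S M? m least 2c-1≤m B bounded

  M-bounded : ∀ B → uM ≤ B → ∀ x → M (m + x) → x < B
  M-bounded B u≤B x Mx = <-≤-trans (≤-<-trans (m≤n+m x m) (proj₂ (HasCard⇒bounded card) (m + x) Mx)) u≤B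

  module SM₀ = SM uM (M-bounded uM ≤-refl)

  δ : ℕ
  δ = count SM₀.D∪? (m + uM)

  D∪M-card : HasCard (D∪ S M) δ
  D∪M-card = SM₀.D∪-card

  minimal : ∀ d → ∃[ N ] (Configuration S m r N × HasCard (D∪ S N) d) → δ ≤ d
  minimal d (N , N-configuration , D∪N-card) = δ≤d (HasCard-inhabited card (proj₁ least))
    where
    N-card = Configuration.card N-configuration
    δ≤d : ∃[ r′ ] r ≡ suc r′ → δ ≤ d
    δ≤d (r′ , r≡) with HasCard⇒least (subst (HasCard N) r≡ N-card)
    -- The gaps of `M` are added to both sides so that `D∪-count` applies; that `e` may exceed `m`
    -- only enlarges `count S? e`.
    ... | e , e-least = +-cancelʳ-≤ (count (KM.Gap? ∘ suc) m) δ d (begin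
      δ + count (KM.Gap? ∘ suc) m
        ≡⟨ cong (_+ count (KM.Gap? ∘ suc) m) (HasCard-unique D∪M-card KM.D∪-card) ⟩
      count KM.D∪? (m + B) + count (KM.Gap? ∘ suc) m    ≡⟨ KM.D∪-count ⟩
      count S? m + count KM.Below? B                    ≤⟨ +-mono-≤ (count-monoʳ S? m≤e) Below-≤ ⟩
      count S? e + count KN.Below? B                    ≡⟨ KN.D∪-count ⟨
      count KN.D∪? (e + B) + count (KN.Gap? ∘ suc) e    ≡⟨ cong (_+ count (KN.Gap? ∘ suc) e) (HasCard-unique KN.D∪-card D∪N-card) ⟩
      d + count (KN.Gap? ∘ suc) e                       ≤⟨ +-monoʳ-≤ d Gap-≤ ⟩
      d + count (KM.Gap? ∘ suc) m                       ∎)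
      where
      open ≤-Reasoning
      m≤e : m ≤ e
      m≤e = proj₂ (Configuration.subset N-configuration (proj₁ e-least))
      N-bound = HasCard⇒bounded N-card
      -- With this `h`, the bound `B` is valid for both sets and cuts off the ground followed by
      -- exactly `h` blocks.
      h = uM + proj₁ N-bound
      B = (a + b) + h * a
      h≤B : h ≤ B
      h≤B = ≤-trans (m≤m*n h a) (m≤n+m (h * a) (a + b))
      N-bounded : ∀ x → N (e + x) → x < B
      N-bounded x Nx = <-≤-trans (≤-<-trans (m≤n+m x e) (proj₂ N-bound (e + x) Nx))
        (≤-trans (m≤n+m (proj₁ N-bound) uM) h≤B)
      M-bounded′ = M-bounded B (≤-trans (m≤m+n uM _) h≤B)
      module KM = SM B M-bounded′
      module KN = Shifted c [c,∞⟩⊆S (HasCard⇒decidable N-card) e e-least (≤-trans 2c-1≤m m≤e) B N-bounded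
      module O = Ordered a b 0<b b<a c [c,∞⟩⊆S KM.c≤e oa
      -- Closedness of `M` means that its `Below` adds nothing to it, whereas `Below` of `N`
      -- contains at least `N`.
      Below-≤ : count KM.Below? B ≤ count KN.Below? B
      Below-≤ = begin
        count KM.Below? B  ≤⟨ count-mono KM.Below? KM.A? B (λ { x _ (s , ss , Ms) → O.closed↓ x s Ms ss }) ⟩
        count KM.A? B      ≡⟨ KM.card-shift card ⟨
        r                  ≡⟨ KN.card-shift N-card ⟩
        count KN.A? B      ≤⟨ count-mono KN.A? KN.Below? B (λ _ _ → KN.A⊆Below) ⟩
        count KN.Below? B  ∎
      -- All gaps of both sets are below `c ≤ m ≤ e`, so `e` blocks of length `a` cover them.
      Gap-≤ : count (KN.Gap? ∘ suc) e ≤ count (KM.Gap? ∘ suc) m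
      Gap-≤ = begin
        count (KN.Gap? ∘ suc) e        ≡⟨ count-support (KN.Gap? ∘ suc) (m≤m*n e a) KN.Gap-support ⟩
        count (KN.Gap? ∘ suc) (e * a)
          ≤⟨ gaps-≤ KM.A? KN.A? h M-bounded′ N-bounded O.closed↓ O.t O.t<a+b O.shadow-≤ O.initial O.runs Below-≤ KN.A0 e ⟩
        count (KM.Gap? ∘ suc) (e * a)  ≡⟨ count-support (KM.Gap? ∘ suc) (≤-trans m≤e (m≤m*n e a)) KM.Gap-support ⟨
        count (KM.Gap? ∘ suc) m        ∎
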